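{- For all integers $n \geq 0$ we have $g_n = \sum_{1 \leq i \leq n} k_i$.
   Context: Gutkovskiy's sequence $(g_n)_{n\ge 0}$ is defined by $g_0 = 0$ and $g_n = n - g_{\lfloor g_{n-1}/2 \rfloor}$ for $n \geq 1$. Let $h$ be the morphism on binary words given by $h(1) = 110$ and $h(0) = 11$. The infinite word $\mathbf{k} = k_1 k_2 k_3 \cdots = 1101101111\cdots$ (indexed starting from $1$) is the infinite fixed point of $h$, i.e., the unique infinite word having every $h^n(1)$, $n\ge 0$, as a prefix. Its letters $k_i \in \{0,1\}$ are regarded as integers. -}

module Defs where

open import Data.Fin.Base using (Fin; zero; suc; toℕ; fromℕ<)
open import Data.Fin.Patterns using (0F; 1F)
open import Data.Fin.Properties using (toℕ-fromℕ<; toℕ<n)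
import Data.Integer.Base as ℤ
import Data.Integer.Properties as ℤ
open import Data.List.Base using (List; []; _∷_; _++_; [_]; concatMap; length; lookup)
open import Data.List.Properties using (++-assoc; ++-identityʳ; concatMap-++; length-++)
open import Data.Nat.Base
open import Data.Nat.GeneralisedArithmetic using (fold)
open import Data.Nat.Induction using (<-rec; <-wellFounded)
open import Data.Nat.Properties
open import Data.Product.Base using (∃; _,_; proj₁; proj₂)
open import Data.Sum.Base using (inj₁; inj₂)
open import Induction.WellFounded using (WfRec; module FixPoint)
open import Relation.Binary.PropositionalEquality
  using (_≡_; refl; sym; trans; cong; subst)

-- The nested call g ⌊ g (n - 1) /2⌋ is only seen to be at a smaller
-- argument once g (n - 1) ≤ n - 1 is known, so g is computed together
-- with the bound g n ≤ n.

Bounded : ℕ → Set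
Bounded n = ∃ λ v → v ≤ n

half-bound : ∀ {n} (b : Bounded n) → ⌊ proj₁ b /2⌋ < suc n
half-bound (v , v≤n) = s≤s (≤-trans (⌊n/2⌋≤n v) v≤n)

g-next : ∀ n {m} → Bounded m → Bounded (suc n)
g-next n (w , _) = suc n ∸ w , m∸n≤m (suc n) w

g-step : ∀ n → WfRec _<_ Bounded n → Bounded n
g-step zero    _   = 0 , z≤n
g-step (suc n) rec = g-next n (rec (half-bound (rec (n<1+n n))))

g-bounded : ∀ n → Bounded n
g-bounded = <-rec Bounded g-step

g : ℕ → ℕ
g n = proj₁ (g-bounded n)

g≤n : ∀ n → g n ≤ n
g≤n n = proj₂ (g-bounded n)

private
  g-step-ext : ∀ n {rec rec′ : WfRec _<_ Bounded n} →
               (∀ {m} m<n → rec {m} m<n ≡ rec′ m<n) →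
               g-step n rec ≡ g-step n rec′
  g-step-ext zero    _  = refl
  g-step-ext (suc n) {rec} {rec′} eq =
    trans (cong (λ b → g-next n (rec (half-bound b))) (eq (n<1+n n)))
          (cong (g-next n) (eq (half-bound (rec′ (n<1+n n)))))

g-zero : g 0 ≡ 0
g-zero = refl

g-suc-∸ : ∀ n → g (suc n) ≡ suc n ∸ g ⌊ g n /2⌋
g-suc-∸ n = cong proj₁ (FixPoint.unfold-wfRec <-wellFounded Bounded g-step g-step-ext {suc n})

-- The subtraction above is never truncated.
g-suc : ∀ n → ℤ.+ g (suc n) ≡ ℤ.+ suc n ℤ.- ℤ.+ g ⌊ g n /2⌋
g-suc n = trans (cong ℤ.+_ (g-suc-∸ n))
  (trans (sym (ℤ.⊖-≥ (≤-trans (g≤n ⌊ g n /2⌋) (<⇒≤ (half-bound (g n , g≤n n))))))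
         (sym (ℤ.m-n≡m⊖n (suc n) (g ⌊ g n /2⌋))))

Word : Set
Word = List (Fin 2)

h-letter : Fin 2 → Word
h-letter 0F = 1F ∷ 1F ∷ []
h-letter 1F = 1F ∷ 1F ∷ 0F ∷ []

h : Word → Word
h = concatMap h-letter

h^_[1] : ℕ → Word
h^ n [1] = fold [ 1F ] h n

-- Indexed from 1, whereas `lookup` on finite words is indexed from 0.
InfiniteWord : Set
InfiniteWord = (i : ℕ) → .{{_ : NonZero i}} → Fin 2

_IsPrefixOf_ : Word → InfiniteWord → Set
w IsPrefixOf u = (j : Fin (length w)) → lookup w j ≡ u (suc (toℕ j))

private
  length-h : ∀ w → length w ≤ length (h w)
  length-h []       = z≤n
  length-h (0F ∷ w) = s≤s (m≤n⇒m≤1+n (length-h w))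
  length-h (1F ∷ w) = s≤s (m≤n⇒m≤1+n (m≤n⇒m≤1+n (length-h w)))

  h^-head : ∀ n → ∃ λ w → h^ n [1] ≡ 1F ∷ w
  h^-head zero    = [] , refl
  h^-head (suc n) with w , eq ← h^-head n rewrite eq = _ , refl

h^-length : ∀ n → n < length (h^ n [1])
h^-length zero    = s≤s z≤n
h^-length (suc n) with h^ n [1] | h^-head n | h^-length n
... | _ | w , refl | n<l = s≤s (≤-trans n<l (s≤s (m≤n⇒m≤1+n (length-h w))))

-- The i-th letter is read off h^(i-1)(1), which has length at least i;
-- `𝐤-prefix` and `𝐤-unique` are the defining property of the word.
𝐤 : InfiniteWord
𝐤 (suc i) = lookup (h^ i [1]) (fromℕ< (h^-length i))

private
  h^-extends : ∀ n → ∃ λ s → h^ suc n [1] ≡ h^ n [1] ++ s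
  h^-extends zero    = 1F ∷ 0F ∷ [] , refl
  h^-extends (suc n) with s , eq ← h^-extends n =
    h s , trans (cong h eq) (concatMap-++ h-letter (h^ n [1]) s)

  h^-extends-≤′ : ∀ {m n} → m ≤′ n → ∃ λ s → h^ n [1] ≡ h^ m [1] ++ s
  h^-extends-≤′ (≤′-reflexive refl) = [] , sym (++-identityʳ _)
  h^-extends-≤′ {m} {suc n} (≤′-step m≤n)
    with s , eq ← h^-extends-≤′ m≤n | t , eq′ ← h^-extends n =
    s ++ t , trans eq′ (trans (cong (_++ t) eq) (++-assoc (h^ m [1]) s t))

  lookup-++ : ∀ (w s : Word) (i : Fin (length w)) (j : Fin (length (w ++ s))) →
              toℕ i ≡ toℕ j → lookup w i ≡ lookup (w ++ s) j
  lookup-++ (x ∷ w) s zero    zero    _  = refl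
  lookup-++ (x ∷ w) s (suc i) (suc j) eq = lookup-++ w s i j (suc-injective eq)

  lookup-h^ : ∀ {m n} → m ≤ n → (i : Fin (length (h^ m [1]))) (j : Fin (length (h^ n [1]))) →
              toℕ i ≡ toℕ j → lookup (h^ m [1]) i ≡ lookup (h^ n [1]) j
  lookup-h^ {m} {n} m≤n i j eq with h^ n [1] | h^-extends-≤′ (≤⇒≤′ m≤n)
  ... | _ | s , refl = lookup-++ (h^ m [1]) s i j eq

𝐤-prefix : ∀ n → h^ n [1] IsPrefixOf 𝐤
𝐤-prefix n j with ≤-total n (toℕ j)
... | inj₁ n≤j = lookup-h^ n≤j j _ (sym (toℕ-fromℕ< (h^-length (toℕ j))))
... | inj₂ j≤n = sym (lookup-h^ j≤n _ j (toℕ-fromℕ< (h^-length (toℕ j))))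

𝐤-unique : (u : InfiniteWord) → (∀ n → h^ n [1] IsPrefixOf u) →
           ∀ i → .{{_ : NonZero i}} → u i ≡ 𝐤 i
𝐤-unique u pre (suc i) = sym (trans (pre i (fromℕ< (h^-length i)))
  (cong (λ j → u (suc j)) (toℕ-fromℕ< (h^-length i))))

private
  initial-segment : ∀ (w v : Word) → length w ≤ length v →
                    (∀ i j → toℕ i ≡ toℕ j → lookup w i ≡ lookup v j) →
                    ∃ λ s → v ≡ w ++ s
  initial-segment []      v       _         _  = v , refl
  initial-segment (x ∷ w) (y ∷ v) (s≤s w≤v) eq
    with refl ← eq zero zero refl
    with s , refl ← initial-segment w v w≤v (λ i j p → eq (suc i) (suc j) (cong suc p)) =
    s , refl

  prefix-++ : ∀ w s u → (w ++ s) IsPrefixOf u → w IsPrefixOf u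
  prefix-++ w s u pre j =
    trans (lookup-++ w s j _ (sym (toℕ-fromℕ< j<)))
      (trans (pre (fromℕ< j<)) (cong (λ m → u (suc m)) (toℕ-fromℕ< j<)))
    where
    j< : toℕ j < length (w ++ s)
    j< = <-≤-trans (toℕ<n j) (≤-trans (m≤m+n _ _) (≤-reflexive (sym (length-++ w))))

-- h(𝐤) = 𝐤, expressed on finite prefixes.
𝐤-fixed : ∀ w → w IsPrefixOf 𝐤 → h w IsPrefixOf 𝐤
𝐤-fixed w pre j
  with s , eq ← initial-segment w (h^ length w [1]) (<⇒≤ (h^-length (length w)))
                  (λ i i′ p → trans (pre i)
                    (trans (cong (λ m → 𝐤 (suc m)) p) (sym (𝐤-prefix (length w) i′)))) =
  prefix-++ (h w) (h s) 𝐤 (subst (_IsPrefixOf 𝐤)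
    (trans (cong h eq) (concatMap-++ h-letter w s)) (𝐤-prefix (suc (length w)))) j

{-# OPTIONS --safe #-}

-- In h(w) every letter of w contributes exactly two 1s, and every 1 of w
-- contributes exactly one 0, placed right after them.  So if the first n letters
-- of h(w) contain s ones, the first n + 1 letters contain as many 0s as the first
-- ⌊ s /2⌋ letters of w contain 1s.  Taking for w a long prefix of 𝐤 = h(𝐤),
-- the partial sums of 𝐤 obey the recurrence that defines g.
module Submission where

open import Defs
open import Data.Fin.Base using (Fin; zero; suc; toℕ)
open import Data.Fin.Patterns using (0F; 1F)
open import Data.List.Base using (List; []; _∷_; map; upTo; applyUpTo; take; length; lookup)
open import Data.List.Properties using (map-applyUpTo; map-upTo)
open import Data.Nat.Base using (ℕ; zero; suc; _+_; _∸_; _≤_; _<_; s≤s; ⌊_/2⌋)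
open import Data.Nat.Induction using (<-rec)
open import Data.Nat.ListAction using (sum)
open import Data.Nat.Properties
  using (+-suc; m+n∸n≡m; ≤-trans; ≤-pred; <⇒≤; n<1+n)
open import Data.Product.Base using (_,_)
open import Relation.Binary.PropositionalEquality
  using (_≡_; refl; trans; cong; cong₂; subst; module ≡-Reasoning)

ones : Word → ℕ
ones w = sum (map toℕ w)

-- The number of 0s in the first n + 1 letters is written on the left as
-- n + 1 minus the number of 1s, with the subtraction moved across.
ones-take-h : ∀ w n → n < length (h w) →
              ones (take (suc n) (h w)) + ones (take ⌊ ones (take n (h w)) /2⌋ w) ≡ suc n
ones-take-h (0F ∷ w) 0             _               = refl
ones-take-h (0F ∷ w) 1             _               = refl
-- A whole block dropped from `h w` takes two 1s with it, which lowers the half by one and so drops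
-- exactly one letter of `w`.
ones-take-h (0F ∷ w) (suc (suc n)) (s≤s (s≤s n<l)) =
  cong (2 +_) (ones-take-h w n n<l)
ones-take-h (1F ∷ w) 0             _               = refl
ones-take-h (1F ∷ w) 1             _               = refl
-- The offset between `n` and `suc n` matters here: the first two letters already complete a pair of
-- 1s, and the third is the 0 that follows it.
ones-take-h (1F ∷ w) 2             _               = refl
ones-take-h (1F ∷ w) (suc (suc (suc n))) (s≤s (s≤s (s≤s n<l))) =
  cong (2 +_) (trans (+-suc _ _) (cong suc (ones-take-h w n n<l)))

take≡applyUpTo : ∀ {a} {A : Set a} (f : ℕ → A) (xs : List A) →
                 (∀ j → lookup xs j ≡ f (toℕ j)) →
                 ∀ n → n ≤ length xs → take n xs ≡ applyUpTo f n
take≡applyUpTo f xs       eq zero    _         = refl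
take≡applyUpTo f (x ∷ xs) eq (suc n) (s≤s n≤l) =
  cong₂ _∷_ (eq zero) (take≡applyUpTo (λ i → f (suc i)) xs (λ j → eq (suc j)) n n≤l)

partialSum : ℕ → ℕ
partialSum n = sum (map (λ i → toℕ (𝐤 (suc i))) (upTo n))

-- The right side does not mention `w`, so counts in `w` and in `h w` become values of one function.
ones-prefix : ∀ w → w IsPrefixOf 𝐤 → ∀ n → n ≤ length w → ones (take n w) ≡ partialSum n
ones-prefix w pre n n≤l = cong sum (begin
  map toℕ (take n w)                         ≡⟨ cong (map toℕ) (take≡applyUpTo 𝐤⁺ w pre n n≤l) ⟩
  map toℕ (applyUpTo 𝐤⁺ n)                   ≡⟨ map-applyUpTo 𝐤⁺ toℕ n ⟩
  applyUpTo (λ i → toℕ (𝐤⁺ i)) n             ≡⟨ map-upTo (λ i → toℕ (𝐤⁺ i)) n ⟨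
  map (λ i → toℕ (𝐤⁺ i)) (upTo n)            ∎)
  where
  open ≡-Reasoning
  𝐤⁺ : ℕ → Fin 2
  𝐤⁺ i = 𝐤 (suc i)

partialSum-suc : ∀ n → ⌊ partialSum n /2⌋ ≤ n →
                 partialSum (suc n) + partialSum ⌊ partialSum n /2⌋ ≡ suc n
partialSum-suc n half≤n = begin
  partialSum (suc n) + partialSum ⌊ partialSum n /2⌋
    ≡⟨ cong₂ _+_ (ones-prefix (h w) pre′ (suc n) n<l′)
         (ones-prefix w pre ⌊ partialSum n /2⌋ (≤-trans half≤n n≤l)) ⟨
  ones (take (suc n) (h w)) + ones (take ⌊ partialSum n /2⌋ w)
    ≡⟨ cong (λ s → ones (take (suc n) (h w)) + ones (take ⌊ s /2⌋ w))
         (ones-prefix (h w) pre′ n (<⇒≤ n<l′)) ⟨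
  ones (take (suc n) (h w)) + ones (take ⌊ ones (take n (h w)) /2⌋ w)
    ≡⟨ ones-take-h w n n<l′ ⟩
  suc n ∎
  where
  open ≡-Reasoning
  -- `h w` is `h^ suc n [1]` by definition, so `𝐤-prefix` covers both words.
  w    = h^ n [1]
  pre  = 𝐤-prefix n
  pre′ = 𝐤-prefix (suc n)
  n≤l  = <⇒≤ (h^-length n)
  n<l′ = <⇒≤ (h^-length (suc n))

theorem2 : ∀ (n : ℕ) → g n ≡ sum (map (λ i → toℕ (𝐤 (suc i))) (upTo n))
theorem2 = <-rec (λ n → g n ≡ partialSum n) step
  where
  open ≡-Reasoning
  step : ∀ n → (∀ {m} → m < n → g m ≡ partialSum m) → g n ≡ partialSum n
  step zero    _  = refl
  step (suc n) ih = begin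
    g (suc n)                                    ≡⟨ g-suc-∸ n ⟩
    -- The induction hypothesis serves twice: at the half for the outer `g`, then at `n` for the
    -- inner one.
    suc n ∸ g ⌊ g n /2⌋                          ≡⟨ cong (suc n ∸_) (ih half<) ⟩
    suc n ∸ partialSum ⌊ g n /2⌋                 ≡⟨ cong (λ s → suc n ∸ partialSum ⌊ s /2⌋) gn≡ ⟩
    suc n ∸ r                                    ≡⟨ cong (_∸ r) (partialSum-suc n half≤n) ⟨
    partialSum (suc n) + r ∸ r                   ≡⟨ m+n∸n≡m (partialSum (suc n)) r ⟩
    partialSum (suc n)                           ∎
    where
    gn≡    = ih (n<1+n n)
    half<  = half-bound (g n , g≤n n)
    -- The bound comes from `g n ≤ n`, carried over to `partialSum n` along `gn≡`.
    half≤n = subst (λ s → ⌊ s /2⌋ ≤ n) gn≡ (≤-pred half<)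
    r      = partialSum ⌊ partialSum n /2⌋
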